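{- Every bipartite amoeba $G$ is omnitonal, and ${\rm ot}(n,G)={\rm ex}(n,G)$ and ${\rm Ot}(n,G)={\rm Ex}(n,G)$ for every $n$ satisfying $\binom n2\ge 2\,{\rm ex}(n,G)+1$ and $n\ge n_0(G)$.
   Context: Graphs are finite and simple with at least one edge; $n(G)=|V(G)|$, $e(G)=|E(G)|$. Amoebas. Isolated vertices play no role here, so copies of $G$ in $K_n$ are regarded as determined by their edge sets. For a graph $G$ embedded in $K_n$, $n\ge n(G)$, a graph $H$ embedded in $K_n$ is obtained from $G$ by an edge-replacement if for some $e_1\in E(G)$ and $e_2\in E(K_n)\setminus E(G)$ we have $E(H)=(E(G)\setminus\{e_1\})\cup\{e_2\}$. A graph $G$ is an amoeba if there is an integer $n_0=n_0(G)>n(G)$ such that for all $n\ge n_0$ and any two copies $F$ and $H$ of $G$ in $K_n$ there is a chain $F=G_0,G_1,\dots,G_t=H$ such that, for every $i\in\{1,\dots,t\}$, $G_i\cong G$ and $G_i$ is obtained from $G_{i-1}$ by an edge-replacement. Turán numbers. ${\rm ex}(n,G)$ is the maximum number of edges in an $n$-vertex graph containing no copy of $G$, and ${\rm Ex}(n,G)$ is the family (up to isomorphism) of $n$-vertex graphs with ${\rm ex}(n,G)$ edges containing no copy of $G$. Omnitonal graphs. A $2$-coloring $E(K_n)=E(R)\cup E(B)$ is a partition of the edges of $K_n$ into red and blue edges, forming the spanning subgraphs $R$ and $B$. An $(r,b)$-colored copy of $G$ (with $r+b=e(G)$) is a (not necessarily induced) subgraph of $K_n$ isomorphic to $G$ with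 exactly $r$ red and $b$ blue edges. ${\rm ot}(n,G)$ is the minimum non-negative integer $s$ such that every $2$-coloring $E(K_n)=E(R)\cup E(B)$ with $\min\{e(R),e(B)\}>s$ contains an $(r,b)$-colored copy of $G$ for every pair of integers $r,b\ge0$ with $r+b=e(G)$. The graph $G$ is omnitonal if for every sufficiently large $n$ such an integer exists non-vacuously, that is, ${\rm ot}(n,G)<\lfloor\frac12\binom n2\rfloor$ (so that there are colorings with $\min\{e(R),e(B)\}>{\rm ot}(n,G)$). ${\rm Ot}(n,G)$ is the family (up to isomorphism) of $n$-vertex graphs with exactly ${\rm ot}(n,G)$ edges such that a coloring $E(K_n)=E(R)\cup E(B)$ with $\min\{e(R),e(B)\}={\rm ot}(n,G)$ contains no $(r,b)$-colored copy of $G$ for some pair $r,b\ge0$ with $r+b=e(G)$ if and only if $R$ or $B$ is isomorphic to some $H\in{\rm Ot}(n,G)$. -}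

module Defs where

open import Data.Bool.Base using (Bool; true; false; not; _∧_; T)
open import Data.Bool.Properties using (∧-comm; ∧-idem; not-involutive)
open import Data.Fin.Base using (Fin; zero; suc; toℕ; fromℕ<)
open import Data.Fin.Permutation using (Permutation′; _⟨$⟩ʳ_)
open import Data.Fin.Properties using (_≟_; _<?_; any?; all?; toℕ-fromℕ<; toℕ≤pred[n])
open import Data.List.Base using (List; allFin; cartesianProduct; filter; length)
open import Data.List.Properties using (filter-≐; filter-none; length-filter)
open import Data.List.Relation.Unary.All using (universal)
open import Data.Nat.Base using (ℕ; zero; suc; _+_; _∸_; _/_; _≤_; _<_; _≥_; _>_; _⊓_; z≤n; s≤s)
open import Data.Nat.Combinatorics using (_C_)
import Data.Nat.Properties as ℕ
open import Data.Product.Base using (Σ; ∃; ∃-syntax; _×_; _,_; proj₁; proj₂)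
open import Data.Sum.Base using (_⊎_)
open import Data.Vec.Functional using (_∷_)
open import Function.Base using (_∘_)
open import Function.Bundles using (_⇔_; mk⇔; module Equivalence)
open import Function.Definitions using (Injective)
open import Level using (0ℓ)
open import Relation.Binary.PropositionalEquality
  using (_≡_; _≢_; refl; sym; trans; cong; cong₂; subst; subst₂)
open import Relation.Nullary.Decidable
  using (Dec; yes; no; does; map′; T?; dec-true; dec-false; ¬?; _×-dec_; _→-dec_;
         decidable-stable; does-≡)
open import Relation.Nullary.Negation using (¬_; contradiction)
open import Relation.Unary using (Pred; Decidable)

record Graph (n : ℕ) : Set where
  field
    adj        : Fin n → Fin n → Bool
    adj-sym    : ∀ i j → adj i j ≡ adj j i
    adj-irrefl : ∀ i → adj i i ≡ false

  Adj : Fin n → Fin n → Set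
  Adj i j = T (adj i j)

open Graph public

private variable
  m n : ℕ

-- Each unordered pair is listed once, with its smaller end first.
edges : Graph n → List (Fin n × Fin n)
edges {n} G =
  filter (λ (i , j) → (i <? j) ×-dec T? (adj G i j))
         (cartesianProduct (allFin n) (allFin n))

e : Graph n → ℕ
e G = length (edges G)

record Graph⁺ : Set where
  field
    order    : ℕ
    graph    : Graph order
    has-edge : ∃[ i ] ∃[ j ] Adj graph i j

open Graph⁺ public

-- Equality of edge sets, for graphs on the same labelled vertex set.
_≐_ : Graph n → Graph n → Set
G ≐ H = ∀ i j → adj G i j ≡ adj H i j

_⊆_ : Graph n → Graph n → Set
G ⊆ H = ∀ i j → Adj G i j → Adj H i j

_∩_ : Graph n → Graph n → Graph n
G ∩ H = record
  { adj        = λ i j → adj G i j ∧ adj H i j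
  ; adj-sym    = λ i j → cong₂ _∧_ (adj-sym G i j) (adj-sym H i j)
  ; adj-irrefl = λ i → cong (_∧ adj H i i) (adj-irrefl G i)
  }

_≅_ : Graph n → Graph n → Set
_≅_ {n} G H =
  Σ (Permutation′ n) λ π → ∀ i j → adj G i j ≡ adj H (π ⟨$⟩ʳ i) (π ⟨$⟩ʳ j)

Bipartite : Graph⁺ → Set
Bipartite G =
  Σ (Fin (order G) → Bool) λ side → ∀ u v → Adj (graph G) u v → side u ≢ side v

-- The edge set of F is the image of the edge set of G under an injection of
-- vertices; vertices of F outside the image are isolated.
IsCopy : Graph m → Graph n → Set
IsCopy {m} {n} G F =
  Σ (Fin m → Fin n) λ φ → Injective _≡_ _≡_ φ ×
    (∀ x y → Adj F x y ⇔ (∃[ u ] ∃[ v ] Adj G u v × φ u ≡ x × φ v ≡ y))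

Contains : Graph n → Graph m → Set
Contains {n} H G = Σ (Graph n) λ F → IsCopy G F × F ⊆ H

-- Ordered pairs representing the same unordered pair.
_≈ₑ_ : Fin n × Fin n → Fin n × Fin n → Set
(x , y) ≈ₑ (a , b) = (x ≡ a × y ≡ b) ⊎ (x ≡ b × y ≡ a)

record EdgeReplacement (F H : Graph n) : Set where
  field
    a₁ b₁    : Fin n
    a₂ b₂    : Fin n
    removed  : Adj F a₁ b₁
    added    : a₂ ≢ b₂ × ¬ Adj F a₂ b₂
    replaced : ∀ x y → Adj H x y ⇔
      ((Adj F x y × ¬ ((x , y) ≈ₑ (a₁ , b₁))) ⊎ ((x , y) ≈ₑ (a₂ , b₂)))

data Chain (G : Graph m) {n} : Graph n → Graph n → Set where
  done : ∀ {F H} → F ≐ H → Chain G F H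
  step : ∀ {F F′ H} → EdgeReplacement F F′ → IsCopy G F′ →
         Chain G F′ H → Chain G F H

AmoebaThreshold : Graph⁺ → ℕ → Set
AmoebaThreshold G n₀ =
  order G < n₀ ×
  (∀ n → n ≥ n₀ → (F H : Graph n) →
     IsCopy (graph G) F → IsCopy (graph G) H → Chain (graph G) F H)

Amoeba : Graph⁺ → Set
Amoeba G = ∃ (AmoebaThreshold G)

record Coloring (n : ℕ) : Set where
  field
    red blue  : Graph n
    partition : ∀ i j → i ≢ j → adj red i j ≡ not (adj blue i j)

open Coloring public

HasColoredCopy : Graph m → Coloring n → ℕ → ℕ → Set
HasColoredCopy {n = n} G c r b =
  Σ (Graph n) λ F → IsCopy G F × e (F ∩ red c) ≡ r × e (F ∩ blue c) ≡ b

IsMinimum : Pred ℕ 0ℓ → ℕ → Set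
IsMinimum P k = P k × (∀ j → P j → k ≤ j)

IsMaximum : Pred ℕ 0ℓ → ℕ → Set
IsMaximum P k = P k × (∀ j → P j → j ≤ k)

-- The edge counts of n-vertex graphs containing no copy of G.
FreeSize : ℕ → Graph⁺ → Pred ℕ 0ℓ
FreeSize n G k = Σ (Graph n) λ H → ¬ Contains H (graph G) × e H ≡ k

AllTonalAbove : ℕ → Graph⁺ → Pred ℕ 0ℓ
AllTonalAbove n G s =
  (c : Coloring n) → e (red c) ⊓ e (blue c) > s →
  ∀ r b → r + b ≡ e (graph G) → HasColoredCopy (graph G) c r b

-- Both extrema exist: the predicates are decidable by finite search, the
-- empty graph contains no copy of G, and edge counts are bounded.

module Extrema where

  Searchable : (A : Set) → (A → A → Set) → Set₁
  Searchable A _≈_ =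
    ∀ {P : Pred A 0ℓ} → (∀ {x y} → x ≈ y → P x → P y) → Decidable P → Dec (∃ P)

  search-∀ : ∀ {A : Set} {_≈_ : A → A → Set} → (∀ {x y} → x ≈ y → y ≈ x) →
             Searchable A _≈_ → {P : Pred A 0ℓ} →
             (∀ {x y} → x ≈ y → P x → P y) → Decidable P → Dec (∀ x → P x)
  search-∀ ≈-sym search resp P?
    with search (λ x≈y ¬Px Py → ¬Px (resp (≈-sym x≈y) Py)) (λ x → ¬? (P? x))
  ... | yes (x , ¬Px) = no λ ∀P → ¬Px (∀P x)
  ... | no ¬∃         = yes λ x → decidable-stable (P? x) (λ ¬Px → ¬∃ (x , ¬Px))

  search-fun : ∀ {A : Set} {_≈_ : A → A → Set} → (∀ x → x ≈ x) → Searchable A _≈_ →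
               ∀ m → Searchable (Fin m → A) (λ f g → ∀ i → f i ≈ g i)
  search-fun ≈-refl search zero resp P? =
    map′ (λ p → _ , p) (λ (_ , p) → resp (λ ()) p) (P? (λ ()))
  search-fun {_≈_ = _≈_} ≈-refl search (suc m) resp P? =
    map′ (λ (a , f , p) → a ∷ f , p)
         (λ (f , p) → f zero , f ∘ suc ,
            resp (λ { zero → ≈-refl _ ; (suc i) → ≈-refl _ }) p)
         (search
           (λ x≈y (f , p) →
              f , resp (λ { zero → x≈y ; (suc i) → ≈-refl _ }) p)
           (λ a → search-fun ≈-refl search m
              (λ f≈g → resp (λ { zero → ≈-refl _ ; (suc i) → f≈g i }))
              (λ f → P? (a ∷ f))))

  search-Fin : Searchable (Fin n) _≡_
  search-Fin _ = any?

  search-Bool : Searchable Bool _≡_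
  search-Bool _ P? with P? true | P? false
  ... | yes p | _     = yes (true , p)
  ... | no _  | yes p = yes (false , p)
  ... | no ¬t | no ¬f = no λ { (true , p) → ¬t p ; (false , p) → ¬f p }

  fromFun : (Fin n → Fin n → Bool) → Graph n
  fromFun f = record
    { adj        = λ i j → not (does (i ≟ j)) ∧ (f i j ∧ f j i)
    ; adj-sym    = λ i j → cong₂ _∧_
        (cong not (does-≡ (i ≟ j) (map′ sym sym (j ≟ i))))
        (∧-comm (f i j) (f j i))
    ; adj-irrefl = λ i → cong (λ b → not b ∧ (f i i ∧ f i i)) (dec-true (i ≟ i) refl)
    }

  fromFun-adj : (H : Graph n) → fromFun (adj H) ≐ H
  fromFun-adj H i j with i ≟ j
  ... | yes refl = sym (adj-irrefl H i)
  ... | no _     = trans (cong (adj H i j ∧_) (adj-sym H j i)) (∧-idem (adj H i j))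

  ≐-sym : {F H : Graph n} → F ≐ H → H ≐ F
  ≐-sym p i j = sym (p i j)

  search-Graph : Searchable (Graph n) _≐_
  search-Graph {n} resp P? =
    map′ (λ (f , p) → fromFun f , p)
         (λ (H , p) → adj H , resp (≐-sym {F = fromFun (adj H)} {H} (fromFun-adj H)) p)
         (search-fun (λ _ _ → refl) (search-fun (λ _ → refl) search-Bool n) n
            (λ f≈g → resp λ i j → cong (not (does (i ≟ j)) ∧_)
                                        (cong₂ _∧_ (f≈g i j) (f≈g j i)))
            (λ f → P? (fromFun f)))

  e-resp : {F H : Graph n} → F ≐ H → e F ≡ e H
  e-resp {n} F≐H =
    cong length (filter-≐ _ _
      ( (λ {(i , j)} (lt , a) → lt , subst T (F≐H i j) a)
      , (λ {(i , j)} (lt , a) → lt , subst T (sym (F≐H i j)) a))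
      (cartesianProduct (allFin n) (allFin n)))

  IsCopy-resp : (G : Graph m) {F H : Graph n} → F ≐ H → IsCopy G F → IsCopy G H
  IsCopy-resp G F≐H (φ , inj , eq) = φ , inj , λ x y → mk⇔
    (λ a → Equivalence.to (eq x y) (subst T (sym (F≐H x y)) a))
    (λ p → subst T (F≐H x y) (Equivalence.from (eq x y) p))

  _⇔?_ : {A B : Set} → Dec A → Dec B → Dec (A ⇔ B)
  a? ⇔? b? =
    map′ (λ (f , g) → mk⇔ f g)
         (λ eq → Equivalence.to eq , Equivalence.from eq)
         ((a? →-dec b?) ×-dec (b? →-dec a?))

  injective? : (φ : Fin m → Fin n) → Dec (Injective _≡_ _≡_ φ)
  injective? φ =
    map′ (λ f {x} {y} → f x y) (λ inj x y → inj)
         (all? λ x → all? λ y → (φ x ≟ φ y) →-dec (x ≟ y))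

  isCopy? : (G : Graph m) (F : Graph n) → Dec (IsCopy G F)
  isCopy? {m} G F =
    search-fun (λ _ → refl) search-Fin m
      (λ f≈g (inj , eq) →
         (λ {x} {y} gx≡gy → inj (trans (f≈g x) (trans gx≡gy (sym (f≈g y))))) ,
         λ x y → mk⇔
           (λ a → let (u , v , uv , p , q) = Equivalence.to (eq x y) a in
              u , v , uv , trans (sym (f≈g u)) p , trans (sym (f≈g v)) q)
           (λ (u , v , uv , p , q) → Equivalence.from (eq x y)
              (u , v , uv , trans (f≈g u) p , trans (f≈g v) q)))
      (λ φ → injective? φ ×-dec
         (all? λ x → all? λ y → T? (adj F x y) ⇔?
           (any? λ u → any? λ v → T? (adj G u v) ×-dec (φ u ≟ x) ×-dec (φ v ≟ y))))

  contains? : (H : Graph n) (G : Graph m) → Dec (Contains H G)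
  contains? H G =
    search-Graph
      (λ {F} {F′} F≐F′ (c , F⊆H) → IsCopy-resp G {F} {F′} F≐F′ c ,
         λ i j a → F⊆H i j (subst T (sym (F≐F′ i j)) a))
      (λ F → isCopy? G F ×-dec
         (all? λ i → all? λ j → T? (adj F i j) →-dec T? (adj H i j)))

  contains-resp : (G : Graph m) {H H′ : Graph n} → H ≐ H′ → Contains H G → Contains H′ G
  contains-resp G H≐H′ (F , c , F⊆H) =
    F , c , λ i j a → subst T (H≐H′ i j) (F⊆H i j a)

  freeSize? : ∀ n G → Decidable (FreeSize n G)
  freeSize? n G k =
    search-Graph
      (λ {H} {H′} H≐H′ (free , eq) →
         (λ c → free (contains-resp (graph G) {H′} {H} (≐-sym {F = H} {H′} H≐H′) c)) ,
         trans (sym (e-resp {F = H} {H′} H≐H′)) eq)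
      (λ H → ¬? (contains? H (graph G)) ×-dec (e H ℕ.≟ k))

  bound : ℕ → ℕ
  bound n = length (cartesianProduct (allFin n) (allFin n))

  e≤bound : (H : Graph n) → e H ≤ bound n
  e≤bound {n} H = length-filter _ (cartesianProduct (allFin n) (allFin n))

  maximum : {P : Pred ℕ 0ℓ} → Decidable P → P 0 →
            ∀ N → (∀ j → P j → j ≤ N) → ∃ (IsMaximum P)
  maximum P? p0 zero    ub = 0 , p0 , ub
  maximum P? p0 (suc N) ub with P? (suc N)
  ... | yes p = suc N , p , ub
  ... | no ¬p = maximum P? p0 N λ j pj →
    ℕ.≤-pred (ℕ.≤∧≢⇒< (ub j pj) λ { refl → ¬p pj })

  minimum : {P : Pred ℕ 0ℓ} → Decidable P → ∀ N → P N → ∃ (IsMinimum P)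
  minimum P? zero    p = 0 , p , λ _ _ → z≤n
  minimum P? (suc N) p with P? 0
  ... | yes p0 = 0 , p0 , λ _ _ → z≤n
  ... | no ¬p0 with minimum (P? ∘ suc) N p
  ... | k , pk , least = suc k , pk , λ
    { zero pj → contradiction pj ¬p0 ; (suc j) pj → s≤s (least j pj) }

  empty : Graph n
  empty = record
    { adj = λ _ _ → false ; adj-sym = λ _ _ → refl ; adj-irrefl = λ _ → refl }

  freeSize-0 : ∀ n G → FreeSize n G 0
  freeSize-0 n G = empty ,
    (λ (F , (φ , _ , eq) , F⊆∅) → let (u , v , uv) = has-edge G in
       F⊆∅ (φ u) (φ v) (Equivalence.from (eq (φ u) (φ v)) (u , v , uv , refl , refl))) ,
    cong length (filter-none _
      (universal (λ _ → proj₂) (cartesianProduct (allFin n) (allFin n))))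

  complement : Graph n → Graph n
  complement H = record
    { adj        = λ i j → not (does (i ≟ j)) ∧ not (adj H i j)
    ; adj-sym    = λ i j → cong₂ _∧_
        (cong not (does-≡ (i ≟ j) (map′ sym sym (j ≟ i))))
        (cong not (adj-sym H i j))
    ; adj-irrefl = λ i → cong (λ b → not b ∧ not (adj H i i)) (dec-true (i ≟ i) refl)
    }

  complement-resp : {F H : Graph n} → F ≐ H → complement F ≐ complement H
  complement-resp p i j = cong (λ b → not (does (i ≟ j)) ∧ not b) (p i j)

  coloring : Graph n → Coloring n
  coloring H = record
    { red = H ; blue = complement H
    ; partition = λ i j i≢j → sym (trans
        (cong (λ b → not (not b ∧ not (adj H i j))) (dec-false (i ≟ j) i≢j))
        (not-involutive (adj H i j)))
    }

  blue-complement : (c : Coloring n) → complement (red c) ≐ blue c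
  blue-complement c i j with i ≟ j
  ... | yes refl = sym (adj-irrefl (blue c) i)
  ... | no i≢j   = trans (cong not (partition c i j i≢j)) (not-involutive (adj (blue c) i j))

  hasColoredCopy-resp : (G : Graph m) (c d : Coloring n) {r b : ℕ} →
    red c ≐ red d → blue c ≐ blue d → HasColoredCopy G c r b → HasColoredCopy G d r b
  hasColoredCopy-resp G c d p q (F , copy , er , eb) =
    F , copy ,
    trans (e-resp {F = F ∩ red d} {F ∩ red c} λ i j → cong (adj F i j ∧_) (sym (p i j))) er ,
    trans (e-resp {F = F ∩ blue d} {F ∩ blue c} λ i j → cong (adj F i j ∧_) (sym (q i j))) eb

  hasColoredCopy? : (G : Graph m) (c : Coloring n) → ∀ r b → Dec (HasColoredCopy G c r b)
  hasColoredCopy? G c r b =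
    search-Graph
      (λ {F} {F′} F≐F′ (copy , er , eb) → IsCopy-resp G {F} {F′} F≐F′ copy ,
         trans (sym (e-resp {F = F ∩ red c} {F′ ∩ red c}
                       λ i j → cong (_∧ adj (red c) i j) (F≐F′ i j))) er ,
         trans (sym (e-resp {F = F ∩ blue c} {F′ ∩ blue c}
                       λ i j → cong (_∧ adj (blue c) i j) (F≐F′ i j))) eb)
      (λ F → isCopy? G F ×-dec (e (F ∩ red c) ℕ.≟ r) ×-dec (e (F ∩ blue c) ℕ.≟ b))

  Tonal : Graph m → ℕ → Coloring n → Set
  Tonal G s c = s < e (red c) ⊓ e (blue c) →
    (r : Fin (suc (e G))) → HasColoredCopy G c (toℕ r) (e G ∸ toℕ r)

  tonal-resp : (G : Graph m) (s : ℕ) (c d : Coloring n) →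
    red c ≐ red d → blue c ≐ blue d → Tonal G s c → Tonal G s d
  tonal-resp G s c d p q t lt r = hasColoredCopy-resp G c d p q
    (t (subst (s <_) (sym (cong₂ _⊓_ (e-resp {F = red c} {red d} p)
                                     (e-resp {F = blue c} {blue d} q))) lt) r)

  allTonalAbove? : ∀ n G → Decidable (AllTonalAbove n G)
  allTonalAbove? n G s =
    map′ (λ t c lt r b eq →
            subst₂ (HasColoredCopy (graph G) c)
              (toℕ-fromℕ< (r< r b eq))
              (trans (cong (e (graph G) ∸_) (toℕ-fromℕ< (r< r b eq)))
                     (trans (cong (_∸ r) (sym eq)) (ℕ.m+n∸m≡n r b)))
              (tonal-resp (graph G) s (coloring (red c)) c (λ _ _ → refl)
                 (blue-complement c) (t (red c)) lt (fromℕ< (r< r b eq))))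
         (λ t H lt r → t (coloring H) lt (toℕ r) (e (graph G) ∸ toℕ r)
            (ℕ.m+[n∸m]≡n (toℕ≤pred[n] r)))
         (search-∀ (λ {F} {H} → ≐-sym {F = F} {H}) search-Graph
            (λ {F} {H} F≐H → tonal-resp (graph G) s (coloring F) (coloring H) F≐H
               (complement-resp {F = F} {H} F≐H))
            (λ H → (s ℕ.<? (e H ⊓ e (complement H))) →-dec
               all? λ r → hasColoredCopy? (graph G) (coloring H) (toℕ r)
                            (e (graph G) ∸ toℕ r)))
    where
    r< : ∀ r b → r + b ≡ e (graph G) → r < suc (e (graph G))
    r< r b eq = s≤s (subst (r ≤_) eq (ℕ.m≤m+n r b))

open Extrema using (freeSize?; freeSize-0; allTonalAbove?; maximum; minimum; bound; e≤bound)

abstract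

  ex-exists : ∀ n G → ∃ (IsMaximum (FreeSize n G))
  ex-exists n G = maximum (freeSize? n G) (freeSize-0 n G) (bound n)
    λ { _ (H , _ , refl) → e≤bound H }

  ot-exists : ∀ n G → ∃ (IsMinimum (AllTonalAbove n G))
  ot-exists n G = minimum (allTonalAbove? n G) (bound n)
    λ c lt → contradiction
      (ℕ.<-≤-trans lt (ℕ.≤-trans (ℕ.m⊓n≤m _ (e (blue c))) (e≤bound (red c))))
      (ℕ.<-irrefl refl)

ex : ℕ → Graph⁺ → ℕ
ex n G = proj₁ (ex-exists n G)

ot : ℕ → Graph⁺ → ℕ
ot n G = proj₁ (ot-exists n G)

Omnitonal : Graph⁺ → Set
Omnitonal G = ∃[ N ] (∀ n → n ≥ N → ot n G < (n C 2) / 2)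

Family : ℕ → Set₁
Family n = Pred (Graph n) 0ℓ

-- Equality of families up to isomorphism of their members.
_≋_ : Family n → Family n → Set
_≋_ {n} 𝓕 𝓗 =
  ((F : Graph n) → 𝓕 F → Σ (Graph n) λ H → 𝓗 H × F ≅ H) ×
  ((H : Graph n) → 𝓗 H → Σ (Graph n) λ F → 𝓕 F × H ≅ F)

Ex : ∀ n → Graph⁺ → Family n
Ex n G H = e H ≡ ex n G × ¬ Contains H (graph G)

-- 𝓕 meets the description of Ot(n,G), which is implicit: it need not determine
-- a family when C(n,2) = 2 ot(n,G).
IsOt : ∀ n → Graph⁺ → Family n → Set
IsOt n G 𝓕 =
  ((H : Graph n) → 𝓕 H → e H ≡ ot n G) ×
  ((c : Coloring n) → e (red c) ⊓ e (blue c) ≡ ot n G →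
     (∃[ r ] ∃[ b ] r + b ≡ e (graph G) × ¬ HasColoredCopy (graph G) c r b) ⇔
     (Σ (Graph n) λ H → 𝓕 H × (red c ≅ H ⊎ blue c ≅ H)))

{-# OPTIONS --safe #-}
-- If both colours contain G, a chain of edge-replacements joins a red copy of G
-- to a blue one. Each replacement lowers the number of red edges by at most one,
-- so every count from e(G) down to 0 occurs along the chain. Hence a coloring
-- misses some (r,b) exactly when one colour class is G-free, which yields both
-- ot = ex and Ot = Ex as soon as C(n,2) ≥ 2 ex(n,G) + 1.
--
-- That inequality, with room to spare, holds for bipartite G and large n because
-- a graph with degree sum at least n²/4 contains K_{t,t}: pick 16t vertices
-- of degree at least n/8; linearly many vertices have more than t neighbours
-- among them, and t of these have the same neighbours there.
module Submission where

open import Defs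
open import Algebra.Properties.Semiring.Sum using ()
open import Data.Bool.Base using (Bool; true; false; not; _∧_; T)
open import Data.Bool.Properties using (not-involutive; T-∧; T-≡)
open import Data.Fin.Base using (Fin; zero; suc; fromℕ<)
open import Data.Fin.Permutation using (_⟨$⟩ʳ_) renaming (id to idₚ)
open import Data.Fin.Properties using (_≟_; _<?_; any?; <-cmp; suc-injective; nonZeroIndex)
open import Data.List.Base using (cartesianProduct; filter; length; tabulate; map; _++_)
open import Data.List.Properties using (filter-++; length-++; map-tabulate)
open import Data.Nat.Base using (ℕ; zero; suc; _+_; _*_; _^_; _/_; _%_; _⊓_; _≤_; _<_; _≥_;
  z≤n; s≤s; _<ᵇ_; NonZero; >-nonZero; >-nonZero⁻¹)
open import Data.Nat.Combinatorics using (_C_; nC1≡n; nCk+nC[k+1]≡[n+1]C[k+1])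
open import Data.Nat.DivMod using (m/n*n≤m; m≡m%n+[m/n]*n; m%n<n; /-monoˡ-≤; m*n/n≡m)
import Data.Nat.Properties as ℕ
open import Data.Nat.Tactic.RingSolver using (solve-∀)
open import Data.Product.Base using (Σ; ∃-syntax; _×_; _,_; proj₁; proj₂)
open import Data.Sum.Base using (_⊎_; inj₁; inj₂)
open import Data.Vec.Functional using (_∷_)
open import Function.Base using (_∘_)
open import Function.Bundles using (_⇔_; mk⇔; module Equivalence; module Injection)
open import Function.Definitions using (Injective)
open import Function.Properties.Inverse using (↔⇒↣)
open import Level using (0ℓ)
open import Relation.Binary.Definitions using (tri<; tri≈; tri>)
open import Relation.Binary.PropositionalEquality
open import Relation.Nullary.Decidable using (Dec; yes; no; does; map′; T?;
  dec-true; dec-false; _×-dec_; _⊎-dec_; decidable-stable; does-≡)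
open import Relation.Nullary.Negation using (¬_; contradiction)
open import Relation.Unary using (Pred; Decidable)

open Algebra.Properties.Semiring.Sum ℕ.+-*-semiring
  using (sum; sum-syntax; sum-cong-≗; sum-replicate-zero; ∑-distrib-+; ∑-comm; ∑-permute; *-distribˡ-sum)
open Extrema using (contains?; coloring; e-resp)
open Equivalence using (to; from)

private variable
  m n : ℕ

-- Finite sums, counting and pigeonhole.

∑-mono : {f g : Fin n → ℕ} → (∀ i → f i ≤ g i) → sum f ≤ sum g
∑-mono {zero}  f≤g = z≤n
∑-mono {suc n} f≤g = ℕ.+-mono-≤ (f≤g zero) (∑-mono (f≤g ∘ suc))

∑-const : ∀ n c → sum {n} (λ _ → c) ≡ n * c
∑-const zero    c = refl
∑-const (suc n) c = cong (c +_) (∑-const n c)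

term≤∑ : (f : Fin n → ℕ) → ∀ i → f i ≤ sum f
term≤∑ f zero    = ℕ.m≤m+n _ _
term≤∑ f (suc i) = ℕ.≤-trans (term≤∑ (f ∘ suc) i) (ℕ.m≤n+m _ _)

𝟙 : Bool → ℕ
𝟙 true  = 1
𝟙 false = 0

𝟙-mono : ∀ {a b} → (T a → T b) → 𝟙 a ≤ 𝟙 b
𝟙-mono {false}         _   = z≤n
𝟙-mono {true}  {true}  _   = ℕ.≤-refl
𝟙-mono {true}  {false} a⇒b = contradiction _ a⇒b

𝟙-cong : ∀ {a b} → T a ⇔ T b → 𝟙 a ≡ 𝟙 b
𝟙-cong eq = ℕ.≤-antisym (𝟙-mono (to eq)) (𝟙-mono (from eq))

T⇒𝟙 : ∀ {a} → T a → 𝟙 a ≡ 1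
T⇒𝟙 {true} _ = refl

¬T⇒𝟙 : ∀ {a} → ¬ T a → 𝟙 a ≡ 0
¬T⇒𝟙 {false} _  = refl
¬T⇒𝟙 {true}  ¬a = contradiction _ ¬a

𝟙-split : ∀ a b → 𝟙 a ≡ 𝟙 (a ∧ b) + 𝟙 (a ∧ not b)
𝟙-split false _     = refl
𝟙-split true  true  = refl
𝟙-split true  false = refl

δ : Fin n → Fin n → ℕ
δ a i = 𝟙 (does (a ≟ i))

δ-refl : (i : Fin n) → δ i i ≡ 1
δ-refl i = cong 𝟙 (dec-true (i ≟ i) refl)

∑-δ : (a : Fin n) (h : Fin n → ℕ) → ∑[ i < n ] (δ a i * h i) ≡ h a
∑-δ {suc n} zero    h =
  trans (cong₂ _+_ (ℕ.*-identityˡ (h zero)) (sum-replicate-zero n)) (ℕ.+-identityʳ _)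
∑-δ {suc n} (suc a) h = ∑-δ a (h ∘ suc)

-- By injectivity at most one `u` has `δ (φ u) x` nonzero, so `h x` is the sum of `δ (φ u) x * h x`
-- over `u`; `outside` covers the points that `φ` misses. Exchanging the two sums then evaluates
-- each δ.
∑-reindex : {φ : Fin m → Fin n} → Injective _≡_ _≡_ φ → (h : Fin n → ℕ) →
            (∀ x → (∀ u → φ u ≢ x) → h x ≡ 0) → sum h ≡ sum (h ∘ φ)
∑-reindex {m} {n} {φ} inj h outside = begin
  ∑[ x < n ] h x                             ≡⟨ sum-cong-≗ expand ⟩
  ∑[ x < n ] ∑[ u < m ] (δ (φ u) x * h x)    ≡⟨ ∑-comm {n} {m} (λ x u → δ (φ u) x * h x) ⟩
  ∑[ u < m ] ∑[ x < n ] (δ (φ u) x * h x)    ≡⟨ sum-cong-≗ (λ u → ∑-δ (φ u) h) ⟩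
  ∑[ u < m ] h (φ u)                         ∎
  where
  open ≡-Reasoning
  δ-φ : ∀ u₀ u → δ (φ u) (φ u₀) ≡ δ u₀ u
  δ-φ u₀ u with u₀ ≟ u
  ... | yes refl = δ-refl (φ u₀)
  ... | no u₀≢u  = cong 𝟙 (dec-false (φ u ≟ φ u₀) λ eq → u₀≢u (sym (inj eq)))
  expand : ∀ x → h x ≡ ∑[ u < m ] (δ (φ u) x * h x)
  expand x with any? (λ u → φ u ≟ x)
  ... | yes (u₀ , refl) = sym (trans (sum-cong-≗ λ u → cong (_* h (φ u₀)) (δ-φ u₀ u))
                                     (∑-δ u₀ (λ _ → h (φ u₀))))
  ... | no ¬∃ = trans hx≡0 (sym (trans
    (sum-cong-≗ λ u → trans (cong (δ (φ u) x *_) hx≡0) (ℕ.*-zeroʳ (δ (φ u) x)))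
    (sum-replicate-zero m)))
    where
    hx≡0 : h x ≡ 0
    hx≡0 = outside x λ u eq → ¬∃ (u , eq)

# : (Fin n → Bool) → ℕ
# p = sum (𝟙 ∘ p)

-- An entry above `D` costs at most `M`, any other at most `D`. Against a lower bound on `sum f`
-- this is the averaging step that yields many large entries.
∑≤count : ∀ M D (f : Fin n → ℕ) → (∀ i → f i ≤ M) →
          sum f ≤ M * # (λ i → D <ᵇ f i) + n * D
∑≤count {n} M D f f≤M = begin
  sum f                                         ≤⟨ ∑-mono bound ⟩
  ∑[ i < n ] (M * 𝟙 (D <ᵇ f i) + D)             ≡⟨ ∑-distrib-+ {n} (λ i → M * 𝟙 (D <ᵇ f i)) (λ _ → D) ⟩
  ∑[ i < n ] (M * 𝟙 (D <ᵇ f i)) + ∑[ i < n ] D  ≡⟨ cong₂ _+_ (sym (*-distribˡ-sum {n} M (λ i → 𝟙 (D <ᵇ f i)))) (∑-const n D) ⟩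
  M * # (λ i → D <ᵇ f i) + n * D                ∎
  where
  open ℕ.≤-Reasoning
  bound : ∀ i → f i ≤ M * 𝟙 (D <ᵇ f i) + D
  bound i with D ℕ.<? f i
  ... | yes D<f = ℕ.≤-trans (f≤M i) (ℕ.≤-trans (ℕ.≤-reflexive (sym
    (trans (cong (M *_) (T⇒𝟙 (ℕ.<⇒<ᵇ D<f))) (ℕ.*-identityʳ M)))) (ℕ.m≤m+n _ D))
  ... | no D≮f = ℕ.≤-trans (ℕ.≮⇒≥ D≮f) (ℕ.m≤n+m D _)

select : ∀ t (p : Fin n → Bool) → t ≤ # p →
         ∃[ f ] Injective _≡_ _≡_ f × (∀ (i : Fin t) → T (p (f i)))
select {zero} zero p _ = (λ ()) , (λ { {()} }) , λ ()
select {suc n} t p t≤ with p zero in eq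
... | false = let (f , inj , pf) = select t (p ∘ suc) t≤ in
  suc ∘ f , inj ∘ suc-injective , pf
... | true with t
...   | zero = (λ ()) , (λ { {()} }) , λ ()
...   | suc t′ = let (f , inj , pf) = select t′ (p ∘ suc) (ℕ.≤-pred t≤) in
  zero ∷ suc ∘ f ,
  (λ { {zero} {zero} _ → refl ; {suc _} {suc _} q → cong suc (inj (suc-injective q)) }) ,
  λ { zero → from T-≡ eq ; (suc i) → pf i }

-- Each `b i` splits the vertices satisfying `p` in two, and one part keeps at least half of the
-- required `2 ^ suc m * t`. After all splittings `t` vertices remain, and `c` records the parts
-- taken.
pigeonhole : ∀ m t (p : Fin n → Bool) (b : Fin m → Fin n → Bool) → 2 ^ m * t ≤ # p →
  Σ (Fin m → Bool) λ c → Σ (Fin t → Fin n) λ f →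
    Injective _≡_ _≡_ f × (∀ j → T (p (f j))) × (∀ i j → b i (f j) ≡ c i)
pigeonhole zero t p b large =
  let (f , inj , pf) = select t p (subst (_≤ # p) (ℕ.+-identityʳ t) large) in
  (λ ()) , f , inj , pf , λ ()
pigeonhole {n} (suc m) t p b large
  with 2 ^ m * t ℕ.≤? # (λ v → p v ∧ b zero v)
... | yes l =
  let (c , f , inj , pf , bf) = pigeonhole m t _ (b ∘ suc) l in
  true ∷ c , f , inj , (λ j → proj₁ (to T-∧ (pf j))) ,
  λ { zero j → to T-≡ (proj₂ (to (T-∧ {p (f j)}) (pf j))) ; (suc i) → bf i }
... | no ≰ =
  let (c , f , inj , pf , bf) = pigeonhole m t (λ v → p v ∧ not (b zero v)) (b ∘ suc) l in
  false ∷ c , f , inj , (λ j → proj₁ (to T-∧ (pf j))) ,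
  λ { zero j → not-T (proj₂ (to (T-∧ {p (f j)}) (pf j))) ; (suc i) → bf i }
  where
  open ℕ.≤-Reasoning
  not-T : ∀ {a} → T (not a) → a ≡ false
  not-T {false} _ = refl
  l : 2 ^ m * t ≤ # (λ v → p v ∧ not (b zero v))
  l = ℕ.+-cancelˡ-≤ (2 ^ m * t) _ _ (begin
    2 ^ m * t + 2 ^ m * t                   ≡⟨ ℕ.*-distribʳ-+ t (2 ^ m) (2 ^ m) ⟨
    (2 ^ m + 2 ^ m) * t                     ≡⟨ cong (λ k → (2 ^ m + k) * t) (ℕ.+-identityʳ (2 ^ m)) ⟨
    2 ^ suc m * t                           ≤⟨ large ⟩
    # p                                     ≡⟨ sum-cong-≗ (λ v → 𝟙-split (p v) (b zero v)) ⟩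
    ∑[ v < n ] (𝟙 (p v ∧ b zero v) + 𝟙 (p v ∧ not (b zero v))) 
      ≡⟨ ∑-distrib-+ {n} (λ v → 𝟙 (p v ∧ b zero v)) (λ v → 𝟙 (p v ∧ not (b zero v))) ⟩
    # (λ v → p v ∧ b zero v) + # (λ v → p v ∧ not (b zero v))
                                            ≤⟨ ℕ.+-monoˡ-≤ _ (ℕ.≰⇒≥ ≰) ⟩
    2 ^ m * t + # (λ v → p v ∧ not (b zero v)) ∎)

-- Edge counts as degree sums.

length-filter-tabulate : ∀ {A : Set} {P : Pred A 0ℓ} (P? : Decidable P) (f : Fin n → A) →
  length (filter P? (tabulate f)) ≡ ∑[ i < n ] 𝟙 (does (P? (f i)))
length-filter-tabulate {zero}  P? f = refl
length-filter-tabulate {suc n} P? f with does (P? (f zero))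
... | true  = cong suc (length-filter-tabulate P? (f ∘ suc))
... | false = length-filter-tabulate P? (f ∘ suc)

length-filter-product : ∀ {A B : Set} {P : Pred (A × B) 0ℓ} (P? : Decidable P)
  (f : Fin m → A) (g : Fin n → B) →
  length (filter P? (cartesianProduct (tabulate f) (tabulate g))) ≡
    ∑[ i < m ] ∑[ j < n ] 𝟙 (does (P? (f i , g j)))
length-filter-product {zero}      P? f g = refl
length-filter-product {suc m} {n} P? f g = begin
  length (filter P? (row ++ rest))
    ≡⟨ cong length (filter-++ P? row rest) ⟩
  length (filter P? row ++ filter P? rest)
    ≡⟨ length-++ (filter P? row) ⟩
  length (filter P? row) + length (filter P? rest)
    ≡⟨ cong₂ _+_
         (trans (cong (length ∘ filter P?) (map-tabulate g (f zero ,_)))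
                (length-filter-tabulate P? (λ j → f zero , g j)))
         (length-filter-product P? (f ∘ suc) g) ⟩
  ∑[ i < suc m ] ∑[ j < n ] 𝟙 (does (P? (f i , g j))) ∎
  where
  open ≡-Reasoning
  row  = map (f zero ,_) (tabulate g)
  rest = cartesianProduct (tabulate (f ∘ suc)) (tabulate g)

degree : Graph n → Fin n → ℕ
degree H i = # (adj H i)

degreeSum : Graph n → ℕ
degreeSum H = sum (degree H)

-- `e` sees each edge once, with the smaller end first; the transposed sum sees it again. Degree
-- sums run over all pairs, so they admit reindexing and cellwise comparison, and later edge counts
-- are compared through them.
handshake : (H : Graph n) → degreeSum H ≡ 2 * e H
handshake {n} H = sym (begin
  2 * e H                                          ≡⟨ cong (2 *_) (length-filter-product {n} {n}
                                                       (λ (i , j) → (i <? j) ×-dec T? (adj H i j)) (λ i → i) (λ j → j)) ⟩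
  2 * S                                            ≡⟨ cong (S +_) (ℕ.+-identityʳ S) ⟩
  S + S                                            ≡⟨ cong (S +_) (∑-comm {n} {n} o) ⟩
  S + ∑[ i < n ] ∑[ j < n ] o j i                  ≡⟨ ∑-distrib-+ {n} (λ i → ∑[ j < n ] o i j) (λ i → ∑[ j < n ] o j i) ⟨
  ∑[ i < n ] (∑[ j < n ] o i j + ∑[ j < n ] o j i) ≡⟨ sum-cong-≗ (λ i → ∑-distrib-+ {n} (o i) (λ j → o j i)) ⟨
  ∑[ i < n ] ∑[ j < n ] (o i j + o j i)            ≡⟨ sum-cong-≗ (λ i → sum-cong-≗ (both i)) ⟩
  degreeSum H                                      ∎)
  where
  open ≡-Reasoning
  o : Fin n → Fin n → ℕ
  o i j = 𝟙 (does (i <? j) ∧ adj H i j)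
  S = ∑[ i < n ] ∑[ j < n ] o i j
  both : ∀ i j → o i j + o j i ≡ 𝟙 (adj H i j)
  both i j with <-cmp i j
  ... | tri< i<j _ j≮i rewrite dec-true (i <? j) i<j | dec-false (j <? i) j≮i =
    ℕ.+-identityʳ _
  ... | tri≈ i≮i refl _ rewrite dec-false (i <? i) i≮i | adj-irrefl H i = refl
  ... | tri> i≮j _ j<i rewrite dec-true (j <? i) j<i | dec-false (i <? j) i≮j =
    cong 𝟙 (adj-sym H j i)

e-≡ : {F : Graph m} {H : Graph n} → degreeSum F ≡ degreeSum H → e F ≡ e H
e-≡ {F = F} {H} eq = ℕ.*-cancelˡ-≡ (e F) (e H) 2
  (trans (sym (handshake F)) (trans eq (handshake H)))

degreeSum-+ : (F H K : Graph n) →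
  (∀ i j → 𝟙 (adj F i j) ≡ 𝟙 (adj H i j) + 𝟙 (adj K i j)) →
  degreeSum F ≡ degreeSum H + degreeSum K
degreeSum-+ {n} F H K eq = trans
  (sum-cong-≗ λ i → trans (sum-cong-≗ (eq i))
                          (∑-distrib-+ {n} (λ j → 𝟙 (adj H i j)) (λ j → 𝟙 (adj K i j))))
  (∑-distrib-+ {n} (degree H) (degree K))

e-split : (c : Coloring n) (F : Graph n) → e F ≡ e (F ∩ red c) + e (F ∩ blue c)
e-split c F = ℕ.*-cancelˡ-≡ _ _ 2 (begin
  2 * e F                                     ≡⟨ handshake F ⟨
  degreeSum F                                 ≡⟨ degreeSum-+ F (F ∩ red c) (F ∩ blue c) parts ⟩
  degreeSum (F ∩ red c) + degreeSum (F ∩ blue c)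
                                              ≡⟨ cong₂ _+_ (handshake (F ∩ red c)) (handshake (F ∩ blue c)) ⟩
  2 * e (F ∩ red c) + 2 * e (F ∩ blue c)      ≡⟨ ℕ.*-distribˡ-+ 2 (e (F ∩ red c)) _ ⟨
  2 * (e (F ∩ red c) + e (F ∩ blue c))        ∎)
  where
  open ≡-Reasoning
  parts : ∀ i j → 𝟙 (adj F i j) ≡ 𝟙 (adj (F ∩ red c) i j) + 𝟙 (adj (F ∩ blue c) i j)
  parts i j with i ≟ j
  ... | yes refl rewrite adj-irrefl F i = refl
  ... | no i≢j rewrite partition c i j i≢j = trans
    (𝟙-split (adj F i j) (adj (blue c) i j)) (ℕ.+-comm (𝟙 (adj F i j ∧ adj (blue c) i j)) _)

-- The formula `n(n-1)/2` freed of division and subtraction; Pascal's rule drives the induction.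
2*nC2+n≡n*n : ∀ n → 2 * (n C 2) + n ≡ n * n
2*nC2+n≡n*n zero    = refl
2*nC2+n≡n*n (suc n) = begin
  2 * (suc n C 2) + suc n     ≡⟨ cong (λ k → 2 * k + suc n) (nCk+nC[k+1]≡[n+1]C[k+1] n 1) ⟨
  2 * (n C 1 + n C 2) + suc n ≡⟨ cong (λ k → 2 * (k + n C 2) + suc n) (nC1≡n n) ⟩
  2 * (n + n C 2) + suc n     ≡⟨ rearr n (n C 2) ⟩
  (2 * (n C 2) + n) + (1 + 2 * n) ≡⟨ cong (_+ (1 + 2 * n)) (2*nC2+n≡n*n n) ⟩
  n * n + (1 + 2 * n)         ≡⟨ square n ⟩
  suc n * suc n               ∎
  where
  open ≡-Reasoning
  rearr : ∀ n c → 2 * (n + c) + suc n ≡ (2 * c + n) + (1 + 2 * n)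
  rearr = solve-∀
  square : ∀ n → n * n + (1 + 2 * n) ≡ suc n * suc n
  square = solve-∀

e-red+e-blue : (c : Coloring n) → e (red c) + e (blue c) ≡ n C 2
e-red+e-blue {n} c = ℕ.*-cancelˡ-≡ _ _ 2 (ℕ.+-cancelʳ-≡ n _ _ (begin
  2 * (e (red c) + e (blue c)) + n
    ≡⟨ cong (_+ n) (ℕ.*-distribˡ-+ 2 (e (red c)) (e (blue c))) ⟩
  2 * e (red c) + 2 * e (blue c) + n
    ≡⟨ cong (_+ n) (cong₂ _+_ (handshake (red c)) (handshake (blue c))) ⟨
  degreeSum (red c) + degreeSum (blue c) + n
    ≡⟨ cong₂ _+_ (∑-distrib-+ {n} (degree (red c)) (degree (blue c))) (trans (∑-const n 1) (ℕ.*-identityʳ n)) ⟨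
  ∑[ i < n ] (degree (red c) i + degree (blue c) i) + ∑[ i < n ] 1
    ≡⟨ ∑-distrib-+ {n} (λ i → degree (red c) i + degree (blue c) i) (λ _ → 1) ⟨
  ∑[ i < n ] (degree (red c) i + degree (blue c) i + 1)
    ≡⟨ sum-cong-≗ row ⟩
  ∑[ i < n ] n
    ≡⟨ ∑-const n n ⟩
  n * n
    ≡⟨ 2*nC2+n≡n*n n ⟨
  2 * (n C 2) + n ∎))
  where
  open ≡-Reasoning
  R = λ i j → 𝟙 (adj (red c) i j)
  B = λ i j → 𝟙 (adj (blue c) i j)
  -- The δ term fills the diagonal, the one cell of each row with neither colour.
  cell : ∀ i j → R i j + B i j + δ i j * 1 ≡ 1
  cell i j with i ≟ j
  ... | yes refl rewrite adj-irrefl (red c) i | adj-irrefl (blue c) i = refl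
  ... | no i≢j rewrite partition c i j i≢j with adj (blue c) i j
  ...   | true  = refl
  ...   | false = refl
  row : ∀ i → degree (red c) i + degree (blue c) i + 1 ≡ n
  row i = begin
    sum (R i) + sum (B i) + 1
      ≡⟨ cong₂ _+_ (∑-distrib-+ {n} (R i) (B i)) (∑-δ i (λ _ → 1)) ⟨
    ∑[ j < n ] (R i j + B i j) + ∑[ j < n ] (δ i j * 1)
      ≡⟨ ∑-distrib-+ {n} (λ j → R i j + B i j) (λ j → δ i j * 1) ⟨
    ∑[ j < n ] (R i j + B i j + δ i j * 1)
      ≡⟨ sum-cong-≗ (cell i) ⟩
    ∑[ j < n ] 1
      ≡⟨ trans (∑-const n 1) (ℕ.*-identityʳ n) ⟩
    n ∎

no-edges⇒e≡0 : (H : Graph n) → (∀ i j → ¬ Adj H i j) → e H ≡ 0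
no-edges⇒e≡0 {n} H none = ℕ.*-cancelˡ-≡ (e H) 0 2 (trans (sym (handshake H))
  (trans (sum-cong-≗ λ i → trans (sum-cong-≗ λ j → ¬T⇒𝟙 (none i j)) (sum-replicate-zero n))
         (sum-replicate-zero n)))

e≡0⇒no-edges : (H : Graph n) → e H ≡ 0 → ∀ i j → ¬ Adj H i j
e≡0⇒no-edges H e≡0 i j ij = ℕ.<⇒≱ (ℕ.≤-reflexive (sym (T⇒𝟙 ij))) (begin
  𝟙 (adj H i j)  ≤⟨ term≤∑ (λ j → 𝟙 (adj H i j)) j ⟩
  degree H i     ≤⟨ term≤∑ (degree H) i ⟩
  degreeSum H    ≡⟨ trans (handshake H) (cong (2 *_) e≡0) ⟩
  0              ∎)
  where open ℕ.≤-Reasoning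

-- Vertices outside the image of `φ` are isolated in `F`, so both summations of its degree sum pull
-- back along `φ`, where the adjacency matrix becomes that of `G`.
e-copy : (G : Graph m) (F : Graph n) → IsCopy G F → e F ≡ e G
e-copy {m} {n} G F (φ , inj , eq) = e-≡ {F = F} {G} (begin
  degreeSum F                                     ≡⟨ ∑-reindex inj (degree F) outsideˡ ⟩
  ∑[ u < m ] degree F (φ u)                       ≡⟨ sum-cong-≗ (λ u → ∑-reindex inj (λ y → 𝟙 (adj F (φ u) y)) (outsideʳ (φ u))) ⟩
  ∑[ u < m ] ∑[ v < m ] 𝟙 (adj F (φ u) (φ v))     ≡⟨ sum-cong-≗ (λ u → sum-cong-≗ λ v → 𝟙-cong (edge u v)) ⟩
  degreeSum G                                     ∎)
  where
  open ≡-Reasoning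
  outsideʳ : ∀ x y → (∀ v → φ v ≢ y) → 𝟙 (adj F x y) ≡ 0
  outsideʳ x y y∉φ = ¬T⇒𝟙 λ xy → let (_ , v , _ , _ , p) = to (eq x y) xy in y∉φ v p
  outsideˡ : ∀ x → (∀ u → φ u ≢ x) → degree F x ≡ 0
  outsideˡ x x∉φ = trans
    (sum-cong-≗ λ y → trans (cong 𝟙 (adj-sym F x y)) (outsideʳ y x x∉φ))
    (sum-replicate-zero n)
  edge : ∀ u v → Adj F (φ u) (φ v) ⇔ Adj G u v
  edge u v = mk⇔
    (λ xy → let (u′ , v′ , uv , p , q) = to (eq _ _) xy in subst₂ (Adj G) (inj p) (inj q) uv)
    (λ uv → from (eq _ _) (u , v , uv , refl , refl))

e-iso : (F H : Graph n) → F ≅ H → e F ≡ e H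
e-iso {n} F H (π , eq) = e-≡ {F = F} {H} (sym (begin
  degreeSum H                            ≡⟨ ∑-permute (degree H) π ⟩
  ∑[ i < n ] degree H (π ⟨$⟩ʳ i)         ≡⟨ sum-cong-≗ (λ i → ∑-permute (λ y → 𝟙 (adj H (π ⟨$⟩ʳ i) y)) π) ⟩
  ∑[ i < n ] ∑[ j < n ] 𝟙 (adj H (π ⟨$⟩ʳ i) (π ⟨$⟩ʳ j))
                                         ≡⟨ sum-cong-≗ (λ i → sum-cong-≗ λ j → cong 𝟙 (eq i j)) ⟨
  degreeSum F                            ∎))
  where open ≡-Reasoning

-- Copies as embeddings.

T-does : {A : Set} (a? : Dec A) → T (does a?) ⇔ A
T-does (yes a) = mk⇔ (λ _ → a) (λ _ → _)
T-does (no ¬a) = mk⇔ (λ ()) ¬a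

-- Containment with the intermediate copy removed: `φ` determines its edges, and `image` rebuilds
-- it. Isomorphisms then act on the vertex map alone.
Embedding : Graph m → Graph n → Set
Embedding {m} {n} G H =
  Σ (Fin m → Fin n) λ φ → Injective _≡_ _≡_ φ × (∀ u v → Adj G u v → Adj H (φ u) (φ v))

embedding⇒contains : (G : Graph m) (H : Graph n) → Embedding G H → Contains H G
embedding⇒contains {m} {n} G H (φ , inj , hom) =
  image , (φ , inj , λ x y → T-does (edge? x y)) ,
  λ x y xy → let (u , v , uv , p , q) = to (T-does (edge? x y)) xy in
    subst₂ (Adj H) p q (hom u v uv)
  where
  Edge : Fin n → Fin n → Set
  Edge x y = ∃[ u ] ∃[ v ] Adj G u v × φ u ≡ x × φ v ≡ y
  edge? : ∀ x y → Dec (Edge x y)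
  edge? x y = any? λ u → any? λ v → T? (adj G u v) ×-dec (φ u ≟ x) ×-dec (φ v ≟ y)
  Edge-sym : ∀ {x y} → Edge x y → Edge y x
  Edge-sym (u , v , uv , p , q) = v , u , subst T (adj-sym G u v) uv , q , p
  image : Graph n
  image = record
    { adj        = λ x y → does (edge? x y)
    ; adj-sym    = λ x y → does-≡ (edge? x y) (map′ Edge-sym Edge-sym (edge? y x))
    ; adj-irrefl = λ x → dec-false (edge? x x) λ (u , v , uv , p , q) →
        subst T (trans (cong (adj G u) (inj (trans q (sym p)))) (adj-irrefl G u)) uv
    }

contains⇒embedding : (G : Graph m) (H : Graph n) → Contains H G → Embedding G H
contains⇒embedding G H (F , (φ , inj , eq) , F⊆H) =
  φ , inj , λ u v uv → F⊆H _ _ (from (eq _ _) (u , v , uv , refl , refl))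

contains-iso : (G : Graph m) (H K : Graph n) → H ≅ K → Contains H G → Contains K G
contains-iso G H K (π , iso) H⊇G =
  let (φ , inj , hom) = contains⇒embedding G H H⊇G in
  embedding⇒contains G K
    ((π ⟨$⟩ʳ_) ∘ φ , inj ∘ Injection.injective (↔⇒↣ π) ,
     λ u v uv → subst T (iso _ _) (hom u v uv))

≅-refl : (H : Graph n) → H ≅ H
≅-refl H = idₚ , λ _ _ → refl

-- Edge-replacements and intermediate values.

-- Only the edge `a₁b₁` can leave, so at most the cells `(a₁ , b₁)` and `(b₁ , a₁)` of the adjacency
-- matrix fall from 1 to 0. The two products of δ's are the indicators of these cells and add 2 to
-- the degree sum.
e-replacement : (K F F′ : Graph n) → EdgeReplacement F F′ → e (F ∩ K) ≤ suc (e (F′ ∩ K))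
e-replacement {n} K F F′ rep = ℕ.*-cancelˡ-≤ 2 (begin
  2 * e (F ∩ K)                      ≡⟨ handshake (F ∩ K) ⟨
  degreeSum (F ∩ K)                  ≤⟨ ∑-mono (λ x → ∑-mono (cell x)) ⟩
  ∑[ x < n ] ∑[ y < n ] (𝟙 (adj (F′ ∩ K) x y) + (δ a₁ x * (δ b₁ y * 1) + δ b₁ x * (δ a₁ y * 1)))
                                     ≡⟨ sum-cong-≗ row ⟩
  ∑[ x < n ] (degree (F′ ∩ K) x + (δ a₁ x * 1 + δ b₁ x * 1))
                                     ≡⟨ ∑-distrib-+ {n} (degree (F′ ∩ K)) (λ x → δ a₁ x * 1 + δ b₁ x * 1) ⟩
  degreeSum (F′ ∩ K) + ∑[ x < n ] (δ a₁ x * 1 + δ b₁ x * 1)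
                                     ≡⟨ cong₂ _+_ (handshake (F′ ∩ K)) (∑-distrib-+ {n} (λ x → δ a₁ x * 1) (λ x → δ b₁ x * 1)) ⟩
  2 * e (F′ ∩ K) + (∑[ x < n ] (δ a₁ x * 1) + ∑[ x < n ] (δ b₁ x * 1))
                                     ≡⟨ cong (2 * e (F′ ∩ K) +_) (cong₂ _+_ (∑-δ a₁ (λ _ → 1)) (∑-δ b₁ (λ _ → 1))) ⟩
  2 * e (F′ ∩ K) + 2                 ≡⟨ trans (ℕ.+-comm _ 2) (sym (ℕ.*-suc 2 (e (F′ ∩ K)))) ⟩
  2 * suc (e (F′ ∩ K))               ∎)
  where
  open ℕ.≤-Reasoning
  open EdgeReplacement rep
  lost : ∀ {x y} → Adj F x y → ¬ Adj F′ x y → (x , y) ≈ₑ (a₁ , b₁)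
  lost {x} {y} xy ¬xy = decidable-stable
    (((x ≟ a₁) ×-dec (y ≟ b₁)) ⊎-dec ((x ≟ b₁) ×-dec (y ≟ a₁)))
    λ ¬≈ → ¬xy (from (replaced x y) (inj₁ (xy , ¬≈)))
  cell : ∀ x y → 𝟙 (adj (F ∩ K) x y) ≤
         𝟙 (adj (F′ ∩ K) x y) + (δ a₁ x * (δ b₁ y * 1) + δ b₁ x * (δ a₁ y * 1))
  cell x y with T? (adj (F ∩ K) x y) | T? (adj (F′ ∩ K) x y)
  ... | no ¬p | _ = ℕ.≤-trans (ℕ.≤-reflexive (¬T⇒𝟙 ¬p)) z≤n
  ... | yes _ | yes q = ℕ.≤-trans (𝟙-mono (λ _ → q)) (ℕ.m≤m+n _ _)
  ... | yes p | no ¬q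
    with lost (proj₁ (to T-∧ p)) (λ xy → ¬q (from T-∧ (xy , proj₂ (to (T-∧ {adj F x y}) p))))
  ... | inj₁ (refl , refl) = ℕ.≤-trans (𝟙-mono _) (ℕ.≤-trans
          (ℕ.≤-reflexive (sym (cong₂ (λ k l → k * (l * 1)) (δ-refl x) (δ-refl y))))
          (ℕ.≤-trans (ℕ.m≤m+n _ _) (ℕ.m≤n+m _ (𝟙 (adj (F′ ∩ K) x y)))))
  ... | inj₂ (refl , refl) = ℕ.≤-trans (𝟙-mono _) (ℕ.≤-trans
          (ℕ.≤-reflexive (sym (cong₂ (λ k l → k * (l * 1)) (δ-refl x) (δ-refl y))))
          (ℕ.≤-trans (ℕ.m≤n+m _ _) (ℕ.m≤n+m _ (𝟙 (adj (F′ ∩ K) x y)))))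
  row : ∀ x → ∑[ y < n ] (𝟙 (adj (F′ ∩ K) x y) + (δ a₁ x * (δ b₁ y * 1) + δ b₁ x * (δ a₁ y * 1)))
            ≡ degree (F′ ∩ K) x + (δ a₁ x * 1 + δ b₁ x * 1)
  row x = trans
    (∑-distrib-+ {n} (λ y → 𝟙 (adj (F′ ∩ K) x y)) (λ y → δ a₁ x * (δ b₁ y * 1) + δ b₁ x * (δ a₁ y * 1)))
    (cong (degree (F′ ∩ K) x +_) (trans
      (∑-distrib-+ {n} (λ y → δ a₁ x * (δ b₁ y * 1)) (λ y → δ b₁ x * (δ a₁ y * 1)))
      (cong₂ _+_ (pull (δ a₁ x) b₁) (pull (δ b₁ x) a₁))))
    where
    pull : ∀ k b → ∑[ y < n ] (k * (δ b y * 1)) ≡ k * 1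
    pull k b = trans (sym (*-distribˡ-sum {n} k (λ y → δ b y * 1))) (cong (k *_) (∑-δ b (λ _ → 1)))

-- The invariant is `r ≤ e (F ∩ K)`: a count that falls by at most one per step cannot pass below
-- `r` without taking the value `r`.
chain-ivt : (G : Graph m) (K F H : Graph n) {r : ℕ} → Chain G F H → IsCopy G F →
            r ≤ e (F ∩ K) → e (H ∩ K) ≤ r →
            Σ (Graph n) λ F′ → IsCopy G F′ × e (F′ ∩ K) ≡ r
chain-ivt G K F H (done F≐H) copy r≤ ≤r =
  F , copy , ℕ.≤-antisym
    (ℕ.≤-trans (ℕ.≤-reflexive (e-resp {F = F ∩ K} {H ∩ K} λ i j → cong (_∧ adj K i j) (F≐H i j))) ≤r)
    r≤
chain-ivt G K F H {r} (step {F′ = F′} rep copy′ chain) copy r≤ ≤r with r ℕ.≟ e (F ∩ K)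
... | yes r≡ = F , copy , sym r≡
-- Here `r < e (F ∩ K) ≤ suc (e (F′ ∩ K))`, which keeps the invariant.
... | no r≢  = chain-ivt G K F′ H chain copy′
  (ℕ.≤-pred (ℕ.≤-trans (ℕ.≤∧≢⇒< r≤ r≢) (e-replacement K F F′ rep))) ≤r

red-blue-disjoint : (c : Coloring n) → ∀ i j → Adj (red c) i j → ¬ Adj (blue c) i j
red-blue-disjoint c i j r b with i ≟ j
... | yes refl = subst T (adj-irrefl (red c) i) r
... | no i≢j = subst T (trans (partition c i j i≢j) (cong not (to T-≡ b))) r

-- Bicliques in dense graphs.

-- A copy of `K_{t,t}`; its sides are disjoint because adjacency is irreflexive.
Biclique : ℕ → Graph n → Set
Biclique {n} t H =
  Σ (Fin t → Fin n) λ A → Σ (Fin t → Fin n) λ B →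
    Injective _≡_ _≡_ A × Injective _≡_ _≡_ B × (∀ i j → Adj H (A i) (B j))

-- Vertex `u` goes to position `u` on its own side, so `K_{m,m}` has room for `G` whatever the sizes
-- of its two classes.
biclique⇒contains : (G : Graph m) (side : Fin m → Bool) →
  (∀ u v → Adj G u v → side u ≢ side v) → (H : Graph n) → Biclique m H → Contains H G
biclique⇒contains {m} {n} G side proper H (A , B , A-inj , B-inj , AB) =
  embedding⇒contains G H (φ , φ-inj _ _ , hom)
  where
  place : Bool → Fin m → Fin n
  place true  = A
  place false = B
  φ : Fin m → Fin n
  φ u = place (side u) u
  A≢B : ∀ u v → A u ≢ B v
  A≢B u v eq = subst T (adj-irrefl H (B v)) (subst (λ x → Adj H x (B v)) eq (AB u v))
  φ-inj : ∀ u v → φ u ≡ φ v → u ≡ v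
  φ-inj u v eq with side u | side v
  ... | true  | true  = A-inj eq
  ... | false | false = B-inj eq
  ... | true  | false = contradiction eq (A≢B u v)
  ... | false | true  = contradiction (sym eq) (A≢B v u)
  hom : ∀ u v → Adj G u v → Adj H (φ u) (φ v)
  hom u v uv with side u | side v | proper u v uv
  ... | true  | false | _  = AB u v
  ... | false | true  | _  = subst T (adj-sym H (A v) (B u)) (AB v u)
  ... | true  | true  | ne = contradiction refl ne
  ... | false | false | ne = contradiction refl ne

#≤n : (p : Fin n → Bool) → # p ≤ n
#≤n {n} p = ℕ.≤-trans (∑-mono λ i → 𝟙-mono {p i} {true} _)
                      (ℕ.≤-reflexive (trans (∑-const n 1) (ℕ.*-identityʳ n)))

m/n<o⇒m≤o*n : ∀ m n o .{{_ : NonZero n}} → m / n < o → m ≤ o * n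
m/n<o⇒m≤o*n m n o lt = begin
  m                    ≡⟨ m≡m%n+[m/n]*n m n ⟩
  m % n + m / n * n    ≤⟨ ℕ.+-monoˡ-≤ (m / n * n) (ℕ.<⇒≤ (m%n<n m n)) ⟩
  suc (m / n) * n      ≤⟨ ℕ.*-monoˡ-≤ n lt ⟩
  o * n                ∎
  where open ℕ.≤-Reasoning

-- Vertices of degree at most `n / 8` account for at most half of a degree sum of `n * n / 4`, every
-- other vertex for at most `n`. So at least `n / 8` vertices, hence at least `m`, have larger
-- degree.
high-degree-vertices : ∀ m .{{_ : NonZero n}} (H : Graph n) → 8 * m ≤ n →
  n * n ≤ 4 * degreeSum H →
  Σ (Fin m → Fin n) λ s → Injective _≡_ _≡_ s × (∀ i → n ≤ degree H (s i) * 8)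
high-degree-vertices {n} m H 8m≤n dense =
  let (s , inj , high) = select m (λ i → n / 8 <ᵇ degree H i) enough in
  s , inj , λ i → m/n<o⇒m≤o*n n 8 (degree H (s i)) (ℕ.<ᵇ⇒< (n / 8) (degree H (s i)) (high i))
  where
  open ℕ.≤-Reasoning
  k = # (λ i → n / 8 <ᵇ degree H i)
  n≤8k : n ≤ 8 * k
  -- `dense` is doubled so that the low-degree share, at most `n * n` after scaling by 8, cancels
  -- without subtraction.
  n≤8k = ℕ.*-cancelˡ-≤ n (ℕ.+-cancelʳ-≤ (n * n) _ _ (begin
    n * n + n * n                     ≤⟨ ℕ.+-mono-≤ dense dense ⟩
    4 * degreeSum H + 4 * degreeSum H ≡⟨ ℕ.*-distribʳ-+ (degreeSum H) 4 4 ⟨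
    8 * degreeSum H                   ≤⟨ ℕ.*-monoʳ-≤ 8 (∑≤count n (n / 8) (degree H) (λ i → #≤n (adj H i))) ⟩
    8 * (n * k + n * (n / 8))         ≡⟨ rearr n k (n / 8) ⟩
    n * (8 * k) + n * (n / 8 * 8)     ≤⟨ ℕ.+-monoʳ-≤ _ (ℕ.*-monoʳ-≤ n (m/n*n≤m n 8)) ⟩
    n * (8 * k) + n * n               ∎))
    where
    rearr : ∀ n k q → 8 * (n * k + n * q) ≡ n * (8 * k) + n * (q * 8)
    rearr = solve-∀
  enough : m ≤ k
  enough = ℕ.*-cancelˡ-≤ 8 (ℕ.≤-trans 8m≤n n≤8k)

-- The neighbourhood of v within the image of s takes at most 2 ^ m values.
many-neighbours⇒biclique : ∀ m t .{{_ : NonZero t}} (H : Graph n) (s : Fin m → Fin n) →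
  Injective _≡_ _≡_ s → 2 ^ m * t ≤ # (λ v → t <ᵇ # (λ i → adj H (s i) v)) → Biclique t H
many-neighbours⇒biclique m t H s s-inj enough =
  let (trace , y , y-inj , many , y-trace) =
        pigeonhole m t (λ v → t <ᵇ # (λ i → adj H (s i) v)) (λ i v → adj H (s i) v) enough
      -- All `t` vertices share `trace`, so the neighbour count of any one of them bounds it; this
      -- takes the first, which exists as `t` is nonzero.
      v = fromℕ< (>-nonZero⁻¹ t)
      c≡#trace = sum-cong-≗ λ i → cong 𝟙 (y-trace i v)
      (x , x-inj , x-trace) =
        select t trace (ℕ.<⇒≤ (subst (t <_) c≡#trace (ℕ.<ᵇ⇒< t (# (λ i → adj H (s i) (y v))) (many v))))
  in s ∘ x , y , x-inj ∘ s-inj , y-inj ,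
     λ i j → subst T (sym (y-trace (x i) j)) (x-trace i)

-- Double counting of the pairs `(i , v)` with `s i` adjacent to `v`: there are at least
-- `m * n / 8`, that is `2 * t * n`. Vertices `v` seen at most `t` times account for at most
-- `t * n`, the others for at most `16 * t` each, so at least `n / 16` are seen more than `t` times.
high-degrees⇒biclique : ∀ m t .{{_ : NonZero t}} (H : Graph n) (s : Fin m → Fin n) →
  m ≡ 16 * t → 16 * (2 ^ m * t) ≤ n → Injective _≡_ _≡_ s →
  (∀ i → n ≤ degree H (s i) * 8) → Biclique t H
high-degrees⇒biclique {n} m t H s m≡16t large s-inj high =
  many-neighbours⇒biclique m t H s s-inj (ℕ.*-cancelˡ-≤ 16 (ℕ.≤-trans large n≤16k))
  where
  open ℕ.≤-Reasoning
  c : Fin n → ℕ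
  c v = # (λ i → adj H (s i) v)
  k = # (λ v → t <ᵇ c v)
  n≤16k : n ≤ 16 * k
  n≤16k = ℕ.*-cancelˡ-≤ (8 * t) {{ℕ.m*n≢0 8 t}} (ℕ.+-cancelʳ-≤ (8 * t * n) _ _ (begin
    8 * t * n + 8 * t * n               ≡⟨ rearr₁ t n ⟩
    16 * t * n                          ≡⟨ cong (_* n) m≡16t ⟨
    m * n                               ≡⟨ ∑-const m n ⟨
    ∑[ i < m ] n                        ≤⟨ ∑-mono high ⟩
    ∑[ i < m ] (degree H (s i) * 8)     ≡⟨ sum-cong-≗ (λ i → ℕ.*-comm (degree H (s i)) 8) ⟩
    ∑[ i < m ] (8 * degree H (s i))     ≡⟨ *-distribˡ-sum {m} 8 (degree H ∘ s) ⟨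
    8 * ∑[ i < m ] degree H (s i)       ≡⟨ cong (8 *_) (∑-comm {m} {n} (λ i v → 𝟙 (adj H (s i) v))) ⟩
    8 * sum c                           ≤⟨ ℕ.*-monoʳ-≤ 8 (∑≤count m t c (λ v → #≤n (λ i → adj H (s i) v))) ⟩
    8 * (m * k + n * t)                 ≡⟨ cong (λ m → 8 * (m * k + n * t)) m≡16t ⟩
    8 * (16 * t * k + n * t)            ≡⟨ rearr₂ t n k ⟩
    8 * t * (16 * k) + 8 * t * n        ∎))
    where
    rearr₁ : ∀ t n → 8 * t * n + 8 * t * n ≡ 16 * t * n
    rearr₁ = solve-∀
    rearr₂ : ∀ t n k → 8 * (16 * t * k + n * t) ≡ 8 * t * (16 * k) + 8 * t * n
    rearr₂ = solve-∀

-- The first summand makes room for `16 * t` vertices of high degree; the second lets a sixteenth of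
-- all vertices meet the pigeonhole bound `2 ^ (16 * t) * t`.
bicliqueThreshold : ℕ → ℕ
bicliqueThreshold t = 8 * (16 * t) + 16 * (2 ^ (16 * t) * t)

dense⇒biclique : ∀ t .{{_ : NonZero t}} .{{_ : NonZero n}} (H : Graph n) →
  bicliqueThreshold t ≤ n → n * n ≤ 4 * degreeSum H → Biclique t H
dense⇒biclique t H large dense =
  let (s , s-inj , high) = high-degree-vertices (16 * t) H (ℕ.m+n≤o⇒m≤o (8 * (16 * t)) large) dense
  in high-degrees⇒biclique (16 * t) t H s refl (ℕ.m+n≤o⇒n≤o (8 * (16 * t)) large) s-inj high

-- Turán numbers and tonal colourings.

module _ (G : Graph⁺) (n : ℕ) where

  private
    g = graph G
    E = ex n G

  free⇒e≤ex : (H : Graph n) → ¬ Contains H g → e H ≤ E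
  free⇒e≤ex H free = proj₂ (proj₂ (ex-exists n G)) (e H) (H , free , refl)

  ex<e⇒contains : (H : Graph n) → E < e H → Contains H g
  ex<e⇒contains H lt = decidable-stable (contains? H g) λ free → ℕ.<⇒≱ lt (free⇒e≤ex H free)

  -- An extremal graph omits `G`, hence also `K_{t,t}` with `t` the order of `G`, so `8 * ex` is
  -- below `n * n`, whereas `n C 2` is about half of `n * n`.
  bipartite⇒2*ex+2≤nC2 : Bipartite G → bicliqueThreshold (order G) + 4 ≤ n → 2 * ex n G + 2 ≤ n C 2
  bipartite⇒2*ex+2≤nC2 (side , proper) large with proj₁ (proj₂ (ex-exists n G))
  -- Scaling by 4 and adding `2 * n` turns the right-hand side into `n * n + n * n`; `4 ≤ n` absorbs
  -- the linear terms.
  ... | H , free , eH≡E = ℕ.*-cancelˡ-≤ 4 (ℕ.+-cancelʳ-≤ (2 * n) _ _ (begin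
    4 * (2 * E + 2) + 2 * n                   ≡⟨ rearr₁ E n ⟩
    suc (4 * (2 * E)) + (2 * n + 7)           ≤⟨ ℕ.+-mono-≤ sparse (ℕ.+-monoʳ-≤ (2 * n) (ℕ.≤-trans (ℕ.n≤1+n 7) (ℕ.*-monoʳ-≤ 2 4≤n))) ⟩
    n * n + (2 * n + 2 * n)                   ≡⟨ cong (n * n +_) (ℕ.*-distribʳ-+ n 2 2) ⟨
    n * n + 4 * n                             ≤⟨ ℕ.+-monoʳ-≤ (n * n) (ℕ.*-monoˡ-≤ n 4≤n) ⟩
    n * n + n * n                             ≡⟨ cong₂ _+_ (2*nC2+n≡n*n n) (2*nC2+n≡n*n n) ⟨
    (2 * (n C 2) + n) + (2 * (n C 2) + n)     ≡⟨ rearr₂ (n C 2) n ⟩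
    4 * (n C 2) + 2 * n                       ∎))
    where
    open ℕ.≤-Reasoning
    4≤n : 4 ≤ n
    4≤n = ℕ.≤-trans (ℕ.m≤n+m 4 (bicliqueThreshold (order G))) large
    order≢0 : NonZero (order G)
    order≢0 = nonZeroIndex (proj₁ (has-edge G))
    n≢0 : NonZero n
    n≢0 = >-nonZero (ℕ.≤-trans (s≤s z≤n) 4≤n)
    sparse : suc (4 * (2 * E)) ≤ n * n
    sparse = ℕ.≰⇒> λ dense → free (biclique⇒contains g side proper H
      (dense⇒biclique (order G) {{order≢0}} {{n≢0}} H (ℕ.≤-trans (ℕ.m≤m+n _ 4) large)
        (subst (λ k → n * n ≤ 4 * k) (trans (cong (2 *_) (sym eH≡E)) (sym (handshake H))) dense)))
    rearr₁ : ∀ E n → 4 * (2 * E + 2) + 2 * n ≡ suc (4 * (2 * E)) + (2 * n + 7)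
    rearr₁ = solve-∀
    rearr₂ : ∀ c n → (2 * c + n) + (2 * c + n) ≡ 4 * c + 2 * n
    rearr₂ = solve-∀

  -- The pair `(e g , 0)` forbids blue edges, which puts the whole copy into the red graph.
  red-free⇒untonal : (c : Coloring n) → ¬ Contains (red c) g → ¬ HasColoredCopy g c (e g) 0
  red-free⇒untonal c free (F , copy , _ , no-blue) = free (F , copy , F⊆red)
    where
    F⊆red : F ⊆ red c
    F⊆red i j ij with i ≟ j
    ... | yes refl = contradiction ij (subst T (adj-irrefl F i))
    ... | no i≢j rewrite partition c i j i≢j
      with adj (blue c) i j in eq
    ...   | false = _
    ...   | true  = e≡0⇒no-edges (F ∩ blue c) no-blue i j (from T-∧ (ij , from T-≡ eq))

  blue-free⇒untonal : (c : Coloring n) → ¬ Contains (blue c) g → ¬ HasColoredCopy g c 0 (e g)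
  blue-free⇒untonal c free (F , copy , no-red , all-blue) =
    red-free⇒untonal swapped free (F , copy , all-blue , no-red)
    where
    swapped : Coloring n
    swapped = record
      { red = blue c ; blue = red c
      ; partition = λ i j i≢j → sym (trans (cong not (partition c i j i≢j)) (not-involutive _))
      }

  module _ {n₀ : ℕ} (threshold : AmoebaThreshold G n₀) (n≥n₀ : n ≥ n₀) where

    -- The red count is `e g` on a red copy and 0 on a blue one, so some copy on the chain between
    -- them has exactly `r` red edges; the total then fixes its blue count at `b`.
    both⇒tonal : (c : Coloring n) → Contains (red c) g → Contains (blue c) g →
                 ∀ r b → r + b ≡ e g → HasColoredCopy g c r b
    both⇒tonal c (F , F-copy , F⊆red) (H , H-copy , H⊆blue) r b r+b≡e
      with chain-ivt g (red c) F H (proj₂ threshold n n≥n₀ F H F-copy H-copy) F-copy r≤ ≤r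
      where
      blueless : e (F ∩ blue c) ≡ 0
      blueless = no-edges⇒e≡0 (F ∩ blue c) λ i j p → red-blue-disjoint c i j
        (F⊆red i j (proj₁ (to T-∧ p))) (proj₂ (to (T-∧ {adj F i j}) p))
      redless : e (H ∩ red c) ≡ 0
      redless = no-edges⇒e≡0 (H ∩ red c) λ i j p → red-blue-disjoint c i j
        (proj₂ (to (T-∧ {adj H i j}) p)) (H⊆blue i j (proj₁ (to T-∧ p)))
      open ℕ.≤-Reasoning
      r≤ : r ≤ e (F ∩ red c)
      r≤ = begin
        r                                    ≤⟨ ℕ.m≤m+n r b ⟩
        r + b                                ≡⟨ r+b≡e ⟩
        e g                                  ≡⟨ e-copy g F F-copy ⟨
        e F                                  ≡⟨ e-split c F ⟩
        e (F ∩ red c) + e (F ∩ blue c)       ≡⟨ cong (e (F ∩ red c) +_) blueless ⟩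
        e (F ∩ red c) + 0                    ≡⟨ ℕ.+-identityʳ _ ⟩
        e (F ∩ red c)                        ∎
      ≤r : e (H ∩ red c) ≤ r
      ≤r = subst (_≤ r) (sym redless) z≤n
    ... | F′ , copy , refl = F′ , copy , refl , ℕ.+-cancelˡ-≡ (e (F′ ∩ red c)) _ _
      (trans (sym (e-split c F′)) (trans (e-copy g F′ copy) (sym r+b≡e)))

    module _ (nC2≥2*ex+1 : n C 2 ≥ 2 * ex n G + 1) where

      -- Two classes of at most `ex` edges each cannot share out `2 * ex + 1` pairs.
      other-colour-large : (c : Coloring n) → e (red c) ≤ E → E < e (blue c)
      other-colour-large c red≤ = ℕ.+-cancelˡ-< E _ _ (begin-strict
        E + E                       ≡⟨ cong (E +_) (ℕ.+-identityʳ E) ⟨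
        2 * E                       <⟨ ℕ.m<m+n (2 * E) (s≤s z≤n) ⟩
        2 * E + 1                   ≤⟨ nC2≥2*ex+1 ⟩
        n C 2                       ≡⟨ e-red+e-blue c ⟨
        e (red c) + e (blue c)      ≤⟨ ℕ.+-monoˡ-≤ _ red≤ ⟩
        E + e (blue c)              ∎)
        where open ℕ.≤-Reasoning

      allTonalAbove-ex : AllTonalAbove n G E
      allTonalAbove-ex c lt = both⇒tonal c
        (ex<e⇒contains (red c) (ℕ.m<n⊓o⇒m<n (e (red c)) (e (blue c)) lt))
        (ex<e⇒contains (blue c) (ℕ.m<n⊓o⇒m<o (e (red c)) (e (blue c)) lt))

      -- Colour an extremal graph red and its complement blue: the smaller class has `ex` edges, yet
      -- no copy is entirely red. A value `j` below `ex` would apply to this colouring.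
      allTonalAbove⇒ex≤ : ∀ j → AllTonalAbove n G j → E ≤ j
      allTonalAbove⇒ex≤ j tonal = ℕ.≮⇒≥ λ j<E →
        let (H , free , eH≡E) = proj₁ (proj₂ (ex-exists n G))
            c = coloring H
            E<blue = other-colour-large c (ℕ.≤-reflexive eH≡E)
        in red-free⇒untonal c free
             (tonal c (ℕ.⊓-glb (subst (j <_) (sym eH≡E) j<E) (ℕ.<-trans j<E E<blue))
                    (e g) 0 (ℕ.+-identityʳ (e g)))

      ot≡ex : ot n G ≡ ex n G
      ot≡ex = let (tonal , least) = proj₂ (ot-exists n G) in
        ℕ.≤-antisym (least E allTonalAbove-ex) (allTonalAbove⇒ex≤ (ot n G) tonal)

      min≡ex : (H : Graph n) → e H ≡ E → e (red (coloring H)) ⊓ e (blue (coloring H)) ≡ ot n G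
      min≡ex H eH≡E = trans
        (ℕ.m≤n⇒m⊓n≡m (ℕ.≤-trans (ℕ.≤-reflexive eH≡E)
                        (ℕ.<⇒≤ (other-colour-large (coloring H) (ℕ.≤-reflexive eH≡E)))))
        (trans eH≡E (sym ot≡ex))

      -- By `both⇒tonal`, a missing pair leaves some colour without `G`. That colour has at least
      -- `ex` edges, the minimum, and at most `ex` as a `G`-free graph, so it is extremal.
      -- Conversely, a colour isomorphic to a member admits no monochromatic copy.
      Ex⇒IsOt : (𝓕 : Family n) → 𝓕 ≋ Ex n G → IsOt n G 𝓕
      Ex⇒IsOt 𝓕 (𝓕⇒Ex , Ex⇒𝓕) =
        (λ H H∈𝓕 → let (K , (eK≡E , _) , H≅K) = 𝓕⇒Ex H H∈𝓕 in
           trans (e-iso H K H≅K) (trans eK≡E (sym ot≡ex))) ,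
        λ c min≡ot → mk⇔
          (λ (r , b , r+b≡e , untonal) → extremal c (trans min≡ot ot≡ex) λ R⊇G B⊇G →
             untonal (both⇒tonal c R⊇G B⊇G r b r+b≡e))
          λ { (H , H∈𝓕 , inj₁ R≅H) → e g , 0 , ℕ.+-identityʳ (e g) ,
                red-free⇒untonal c (free H H∈𝓕 ∘ contains-iso g (red c) H R≅H)
            ; (H , H∈𝓕 , inj₂ B≅H) → 0 , e g , refl ,
                blue-free⇒untonal c (free H H∈𝓕 ∘ contains-iso g (blue c) H B≅H) }
        where
        free : ∀ H → 𝓕 H → ¬ Contains H g
        free H H∈𝓕 = let (K , (_ , K-free) , H≅K) = 𝓕⇒Ex H H∈𝓕 in K-free ∘ contains-iso g H K H≅K
        member : (K : Graph n) → E ≤ e K → ¬ Contains K g → Σ (Graph n) λ H → 𝓕 H × K ≅ H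
        member K E≤ K-free = Ex⇒𝓕 K (ℕ.≤-antisym (free⇒e≤ex K K-free) E≤ , K-free)
        extremal : (c : Coloring n) → e (red c) ⊓ e (blue c) ≡ E →
          (Contains (red c) g → ¬ Contains (blue c) g) →
          Σ (Graph n) λ H → 𝓕 H × (red c ≅ H ⊎ blue c ≅ H)
        extremal c min≡E not-both with contains? (red c) g
        ... | yes R⊇G =
          let (H , H∈𝓕 , B≅H) = member (blue c)
                (subst (_≤ e (blue c)) min≡E (ℕ.m⊓n≤n (e (red c)) (e (blue c)))) (not-both R⊇G)
          in H , H∈𝓕 , inj₂ B≅H
        ... | no R-free =
          let (H , H∈𝓕 , R≅H) = member (red c)
                (subst (_≤ e (red c)) min≡E (ℕ.m⊓n≤m (e (red c)) (e (blue c)))) R-free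
          in H , H∈𝓕 , inj₁ R≅H

      -- The description is tested on a graph in red and its complement in blue. For a member `F`
      -- the blue graph exceeds `ex` and contains `G`, so the missing pair forces `F` to be
      -- `G`-free. For an extremal `H` it yields a member isomorphic to `H` or to its complement.
      IsOt⇒Ex : (𝓕 : Family n) → IsOt n G 𝓕 → 𝓕 ≋ Ex n G
      IsOt⇒Ex 𝓕 (size , bad) =
        (λ F F∈𝓕 →
           let eF≡E = trans (size F F∈𝓕) ot≡ex
               c = coloring F
               (r , b , r+b≡e , untonal) =
                 from (bad c (min≡ex F eF≡E)) (F , F∈𝓕 , inj₁ (≅-refl F))
               B⊇G = ex<e⇒contains (blue c) (other-colour-large c (ℕ.≤-reflexive eF≡E))
           in F , (eF≡E , λ F⊇G → untonal (both⇒tonal c F⊇G B⊇G r b r+b≡e)) , ≅-refl F) ,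
        λ { H (eH≡E , free) → represented H eH≡E
              (to (bad (coloring H) (min≡ex H eH≡E))
                  (e g , 0 , ℕ.+-identityʳ (e g) , red-free⇒untonal (coloring H) free)) }
        where
        represented : (H : Graph n) → e H ≡ E →
          (Σ (Graph n) λ F → 𝓕 F × (H ≅ F ⊎ blue (coloring H) ≅ F)) →
          Σ (Graph n) λ F → 𝓕 F × H ≅ F
        represented H eH≡E (F , F∈𝓕 , inj₁ H≅F) = F , F∈𝓕 , H≅F
        -- The complement has more than `ex` edges and members have exactly `ex`, so this case is
        -- void.
        represented H eH≡E (F , F∈𝓕 , inj₂ B≅F) = contradiction
          (trans (e-iso (blue (coloring H)) F B≅F) (trans (size F F∈𝓕) ot≡ex))
          (ℕ.>⇒≢ (other-colour-large (coloring H) (ℕ.≤-reflexive eH≡E)))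

theorem2p14 : (G : Graph⁺) → Bipartite G → Amoeba G →
    Omnitonal G ×
    (∀ n₀ → AmoebaThreshold G n₀ →
    ∀ n → n C 2 ≥ 2 * ex n G + 1 → n ≥ n₀ →
    ot n G ≡ ex n G × (∀ (𝓕 : Family n) → IsOt n G 𝓕 ⇔ 𝓕 ≋ Ex n G))
theorem2p14 G bip (n₀ , threshold) =
  -- From `n₀` on the amoeba property applies, from `N` on the density bound; the sum secures both.
  (n₀ + N , λ n n≥ →
     let gap = bipartite⇒2*ex+2≤nC2 G n bip (ℕ.≤-trans (ℕ.m≤n+m N n₀) n≥) in
     subst (_< (n C 2) / 2)
       (sym (ot≡ex G n threshold (ℕ.≤-trans (ℕ.m≤m+n n₀ N) n≥)
               (ℕ.≤-trans (ℕ.+-monoʳ-≤ (2 * ex n G) (ℕ.n≤1+n 1)) gap)))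
       (half (ex n G) (n C 2) gap)) ,
  λ n₀ threshold n nC2≥ n≥n₀ →
    ot≡ex G n threshold n≥n₀ nC2≥ ,
    λ 𝓕 → mk⇔ (IsOt⇒Ex G n threshold n≥n₀ nC2≥ 𝓕) (Ex⇒IsOt G n threshold n≥n₀ nC2≥ 𝓕)
  where
  N = bicliqueThreshold (order G) + 4
  -- Division rounds down, so `2 * k + 1` would give only `k ≤ c / 2`; one more unit makes it
  -- strict.
  half : ∀ k c → 2 * k + 2 ≤ c → k < c / 2
  half k c le = subst (_≤ c / 2) (m*n/n≡m (suc k) 2) (/-monoˡ-≤ 2
    (subst (_≤ c) (trans (ℕ.+-comm (2 * k) 2) (cong (2 +_) (ℕ.*-comm 2 k))) le))
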